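{- Let $G$ be a finite simple connected graph with at least two vertices. If $G$ is super-$\lambda$ and $r$-regular for some $r$, and $G\ncong K_2$, then $X(G)\cong G$.
   Context: All graphs are finite and simple. For a connected graph $G$, an edge-cut of $G$ is a subset $S\subseteq E(G)$ such that $G-S$ is disconnected; a mincut of $G$ is an edge-cut of minimum cardinality, and this cardinality is the edge-connectivity $\lambda(G)$. The mincut graph $X(G)$ of $G$ is the intersection graph of the mincuts: it has one vertex for each mincut of $G$, and two distinct vertices are adjacent if and only if the corresponding mincuts have non-empty intersection (as sets of edges). A graph $G$ is super-$\lambda$ if every mincut of $G$ is trivial, that is, consists of all the edges incident on some vertex of minimum degree. -}

module Defs where

open import Data.Bool.Properties using () renaming (_≟_ to _≟ᵇ_)
open import Data.Fin using (Fin; _<_)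
open import Data.Fin.Properties using (_≟_; _<?_; any?)
open import Data.Fin.Subset using (Subset; _∈_; _∩_; ∣_∣; Nonempty)
open import Data.Fin.Subset.Properties using (_∈?_; nonempty?; ∩-comm)
open import Data.List using (List; length; lookup; filter; cartesianProduct; allFin)
open import Data.Nat using (ℕ; _≤_)
open import Data.Product using (Σ-syntax; ∃-syntax; _×_; _,_; proj₁; proj₂; map₂)
import Data.Product.Properties as Product
open import Data.Refinement using (Refinement-syntax; value)
import Data.Refinement as Refinement
import Data.Sum as Sum
open import Data.Sum using (_⊎_)
open import Data.Vec using (tabulate)
import Data.Vec.Properties as Vec
open import Function using (_↔_; _⇔_; _∘_; Inverse)
open import Level using (0ℓ)
open import Relation.Binary using (Rel; Symmetric; Decidable; DecidableEquality)
open import Relation.Binary.Construct.Closure.ReflexiveTransitive using (Star)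
open import Relation.Binary.PropositionalEquality using (_≡_; _≢_; refl; sym; ≢-sym; subst)
open import Relation.Nullary using (¬_; Dec; does; ¬?)
open import Relation.Nullary.Decidable using (_×-dec_; _⊎-dec_)

record SimpleGraph (V : Set) : Set₁ where
  field
    Adj    : Rel V 0ℓ
    adj?   : Decidable Adj
    symm   : Symmetric Adj
    irrefl : ∀ {v} → ¬ Adj v v

open SimpleGraph public

infix 4 _≅_

_≅_ : {V W : Set} → SimpleGraph V → SimpleGraph W → Set
_≅_ {V} {W} G H =
  Σ[ f ∈ V ↔ W ] (∀ u v → Adj G u v ⇔ Adj H (Inverse.to f u) (Inverse.to f v))

K : (n : ℕ) → SimpleGraph (Fin n)
K n = record
  { Adj    = _≢_
  ; adj?   = λ u v → ¬? (u ≟ v)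
  ; symm   = ≢-sym
  ; irrefl = λ v≢v → v≢v refl
  }

Connected : {V : Set} → SimpleGraph V → Set
Connected G = ∀ u v → Star (Adj G) u v

Disconnected : {V : Set} → SimpleGraph V → Set
Disconnected G = ¬ Connected G

-- Finite graphs have vertex set Fin n.

module _ {n : ℕ} (G : SimpleGraph (Fin n)) where

  -- Each edge {i , j} is listed exactly once, as the pair (i , j) with i < j.
  edges : List (Fin n × Fin n)
  edges = filter (λ (i , j) → (i <? j) ×-dec adj? G i j)
                 (cartesianProduct (allFin n) (allFin n))

  Edge : Set
  Edge = Fin (length edges)

  EdgeSet : Set
  EdgeSet = Subset (length edges)

  endpoints : Edge → Fin n × Fin n
  endpoints = lookup edges

  Incident : Fin n → Edge → Set
  Incident v e = proj₁ (endpoints e) ≡ v ⊎ proj₂ (endpoints e) ≡ v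

  incident? : ∀ v e → Dec (Incident v e)
  incident? v e = (proj₁ (endpoints e) ≟ v) ⊎-dec (proj₂ (endpoints e) ≟ v)

  incidentEdges : Fin n → EdgeSet
  incidentEdges v = tabulate (λ e → does (incident? v e))

  degree : Fin n → ℕ
  degree v = ∣ incidentEdges v ∣

  Regular : ℕ → Set
  Regular r = ∀ v → degree v ≡ r

  HasMinimumDegree : Fin n → Set
  HasMinimumDegree v = ∀ w → degree v ≤ degree w

  Joins : Edge → Rel (Fin n) 0ℓ
  Joins e u v = endpoints e ≡ (u , v) ⊎ endpoints e ≡ (v , u)

  joins? : ∀ e → Decidable (Joins e)
  joins? e u v = (endpoints e ≟² (u , v)) ⊎-dec (endpoints e ≟² (v , u))
    where
    _≟²_ : DecidableEquality (Fin n × Fin n)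
    _≟²_ = Product.≡-dec _≟_ _≟_

  deleteEdges : EdgeSet → SimpleGraph (Fin n)
  deleteEdges S = record
    { Adj    = λ u v → Adj G u v × ¬ (∃[ e ] e ∈ S × Joins e u v)
    ; adj?   = λ u v → adj? G u v ×-dec ¬? (any? (λ e → (e ∈? S) ×-dec joins? e u v))
    ; symm   = λ (uv , kept) → symm G uv , kept ∘ map₂ (map₂ Sum.swap)
    ; irrefl = irrefl G ∘ proj₁
    }

  IsEdgeCut : EdgeSet → Set
  IsEdgeCut S = Disconnected (deleteEdges S)

  IsMincut : EdgeSet → Set
  IsMincut S = IsEdgeCut S × (∀ T → IsEdgeCut T → ∣ S ∣ ≤ ∣ T ∣)

  IsTrivial : EdgeSet → Set
  IsTrivial S = ∃[ v ] HasMinimumDegree v × S ≡ incidentEdges v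

  SuperLambda : Set
  SuperLambda = ∀ S → IsMincut S → IsTrivial S

  -- A refinement type carries its proof irrelevantly, so mincuts are equal
  -- exactly when they are equal as edge sets.
  Mincut : Set
  Mincut = [ S ∈ EdgeSet ∣ IsMincut S ]

  mincutGraph : SimpleGraph Mincut
  mincutGraph = record
    { Adj    = λ s t → s ≢ t × Nonempty (value s ∩ value t)
    ; adj?   = λ s t → ¬? (Refinement._≟_ (Vec.≡-dec _≟ᵇ_) s t)
                       ×-dec nonempty? (value s ∩ value t)
    ; symm   = λ {s} {t} (s≢t , ne) →
                 ≢-sym s≢t , subst Nonempty (∩-comm (value s) (value t)) ne
    ; irrefl = λ (s≢s , _) → s≢s refl
    }

{-# OPTIONS --safe #-}

-- Every vertex star is an edge cut, of size r by regularity. An edge cut of minimum size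
-- among those with fewer than r edges would be a mincut, hence a star by super-λ, hence of
-- size r; so the mincuts are exactly the stars. Two distinct vertices with the same star
-- have no neighbours but each other, so that G is K₂ by connectedness. Otherwise v ↦ star(v)
-- is a bijection from vertices to mincuts, and two distinct stars meet exactly when their
-- centres are adjacent.

module Submission where

open import Defs
open import Data.Bool using (true)
open import Data.Bool.Properties using () renaming (_≟_ to _≟ᵇ_)
open import Data.Nat using (ℕ; _≤_; _<_; s≤s)
open import Data.Nat.Induction using (<-rec)
open import Data.Nat.Properties using (≮⇒≥; <⇒≢; <-trans)
open import Data.Fin using (Fin; zero; suc; punchIn)
open import Data.Fin.Properties using (_≟_; _<?_; <-cmp; any?; punchInᵢ≢i)
open import Data.Fin.Subset using (_∈_; _∩_; ∣_∣; Nonempty)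
open import Data.Fin.Subset.Properties using (x∈p∩q⁺; x∈p∩q⁻)
open import Data.Irrelevant using ([_])
open import Data.List using (cartesianProduct; allFin)
open import Data.List.Membership.Propositional using () renaming (_∈_ to _∈ˡ_)
open import Data.List.Membership.Propositional.Properties
  using (∈-filter⁺; ∈-filter⁻; ∈-cartesianProduct⁺; ∈-allFin; ∈-lookup)
open import Data.List.Relation.Unary.Any using (index)
open import Data.List.Relation.Unary.Any.Properties using (lookup-index)
open import Data.Product using (∃-syntax; _,_; proj₁; proj₂)
open import Data.Refinement using (value; value-injective; _,_)
open import Data.Sum using (_⊎_; inj₁; inj₂; swap)
open import Data.Vec.Properties using (lookup∘tabulate; lookup⇒[]=; []=⇒lookup; ≡-dec)
open import Function using (_∘_; mk⇔; mk↔ₛ′)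
open import Relation.Binary using (tri<; tri≈; tri>)
open import Relation.Binary.Construct.Closure.ReflexiveTransitive using (Star; ε; _◅_)
open import Relation.Binary.PropositionalEquality
  using (_≡_; _≢_; refl; sym; trans; cong; subst; subst₂)
open import Relation.Nullary using (¬_; Dec; does; yes; no; contradiction)
open import Relation.Nullary.Decidable using (dec-true; dec-false; recompute; decidable-stable; _×-dec_)

module _ {n : ℕ} (G : SimpleGraph (Fin n)) where

  private
    star = incidentEdges G

  Incident⇒∈ : ∀ {v e} → Incident G v e → e ∈ star v
  Incident⇒∈ {v} {e} inc = lookup⇒[]= e (star v)
    (trans (lookup∘tabulate _ e) (dec-true (incident? G v e) inc))

  ∈⇒Incident : ∀ {v e} → e ∈ star v → Incident G v e
  ∈⇒Incident {v} {e} e∈ = decidable-stable (incident? G v e) λ ¬inc →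
    contradiction (trans (sym does≡true) (dec-false (incident? G v e) ¬inc)) λ ()
    where
    does≡true : does (incident? G v e) ≡ true
    does≡true = trans (sym (lookup∘tabulate _ e)) ([]=⇒lookup e∈)

  -- An edge is listed only with its smaller end first, so the order of `u` and `v` decides which of
  -- the two orientations is found in the list.
  Adj⇒Joins : ∀ {u v} → Adj G u v → ∃[ e ] Joins G e u v
  Adj⇒Joins {u} {v} uv with <-cmp u v
  ... | tri< u<v _ _ = index uv∈ , inj₁ (sym (lookup-index uv∈))
    where
    uv∈ : (u , v) ∈ˡ edges G
    uv∈ = ∈-filter⁺ (λ (i , j) → (i <? j) ×-dec adj? G i j)
            (∈-cartesianProduct⁺ (∈-allFin u) (∈-allFin v)) (u<v , uv)
  ... | tri≈ _ refl _ = contradiction uv (irrefl G)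
  ... | tri> _ _ v<u = index vu∈ , inj₂ (sym (lookup-index vu∈))
    where
    vu∈ : (v , u) ∈ˡ edges G
    vu∈ = ∈-filter⁺ (λ (i , j) → (i <? j) ×-dec adj? G i j)
            (∈-cartesianProduct⁺ (∈-allFin v) (∈-allFin u)) (v<u , symm G uv)

  endpoints-Adj : ∀ e → Adj G (proj₁ (endpoints G e)) (proj₂ (endpoints G e))
  endpoints-Adj e = proj₂ (proj₂ (∈-filter⁻ (λ (i , j) → (i <? j) ×-dec adj? G i j)
    {xs = cartesianProduct (allFin n) (allFin n)} (∈-lookup {xs = edges G} e)))

  Joins⇒∈ˡ : ∀ {e u v} → Joins G e u v → e ∈ star u
  Joins⇒∈ˡ (inj₁ p) = Incident⇒∈ (inj₁ (cong proj₁ p))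
  Joins⇒∈ˡ (inj₂ p) = Incident⇒∈ (inj₂ (cong proj₂ p))

  Joins⇒∈ʳ : ∀ {e u v} → Joins G e u v → e ∈ star v
  Joins⇒∈ʳ = Joins⇒∈ˡ ∘ swap

  Joins-∈⇒endpoint : ∀ {e u v w} → Joins G e u v → e ∈ star w → u ≡ w ⊎ v ≡ w
  Joins-∈⇒endpoint (inj₁ p) e∈ with ∈⇒Incident e∈
  ... | inj₁ q = inj₁ (trans (sym (cong proj₁ p)) q)
  ... | inj₂ q = inj₂ (trans (sym (cong proj₂ p)) q)
  Joins-∈⇒endpoint (inj₂ p) e∈ with ∈⇒Incident e∈
  ... | inj₁ q = inj₂ (trans (sym (cong proj₁ p)) q)
  ... | inj₂ q = inj₁ (trans (sym (cong proj₂ p)) q)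

  -- Distinct vertices cannot be the same end of `e`, so they are its two ends, in one order or the
  -- other.
  common-edge⇒Adj : ∀ {e u v} → u ≢ v → e ∈ star u → e ∈ star v → Adj G u v
  common-edge⇒Adj {e} u≢v e∈u e∈v with ∈⇒Incident e∈u | ∈⇒Incident e∈v
  ... | inj₁ p | inj₁ q = contradiction (trans (sym p) q) u≢v
  ... | inj₁ p | inj₂ q = subst₂ (Adj G) p q (endpoints-Adj e)
  ... | inj₂ p | inj₁ q = symm G (subst₂ (Adj G) q p (endpoints-Adj e))
  ... | inj₂ p | inj₂ q = contradiction (trans (sym p) q) u≢v

  Adj⇒stars-meet : ∀ {u v} → Adj G u v → Nonempty (star u ∩ star v)
  Adj⇒stars-meet uv with e , joins ← Adj⇒Joins uv =
    e , x∈p∩q⁺ (Joins⇒∈ˡ joins , Joins⇒∈ʳ joins)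

  -- A walk from `v` to another vertex has a first step, and its edge is among those deleted.
  star-isEdgeCut : ∀ {v w} → v ≢ w → IsEdgeCut G (star v)
  star-isEdgeCut {v} {w} v≢w connected with connected v w
  ... | ε = v≢w refl
  ... | (vx , kept) ◅ _ with e , joins ← Adj⇒Joins vx = kept (e , Joins⇒∈ˡ joins , joins)

  module _ {r : ℕ} (superλ : SuperLambda G) (regular : Regular G r) where

    -- Strong induction on the cardinality replaces the choice of a smallest cut among those with
    -- fewer than `r` edges.
    edgeCut-size : ∀ S → IsEdgeCut G S → r ≤ ∣ S ∣
    edgeCut-size S cut = ≮⇒≥ (<-rec (λ k → ∀ S → ∣ S ∣ ≡ k → IsEdgeCut G S → ¬ ∣ S ∣ < r)
      step ∣ S ∣ S refl cut)
      where
      step : ∀ k → (∀ {j} → j < k → ∀ S → ∣ S ∣ ≡ j → IsEdgeCut G S → ¬ ∣ S ∣ < r) →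
             ∀ S → ∣ S ∣ ≡ k → IsEdgeCut G S → ¬ ∣ S ∣ < r
      step _ smaller S refl cut S<r
        -- `S` is a mincut: a cut `T` smaller than `S` would also have fewer than `r` edges, which
        -- the induction hypothesis excludes.
        with v , _ , S≡star ← superλ S (cut , λ T cutT →
               ≮⇒≥ λ T<S → smaller T<S T refl cutT (<-trans T<S S<r))
        = <⇒≢ S<r (trans (cong ∣_∣ S≡star) (regular v))

    star-isMincut : ∀ {v w} → v ≢ w → IsMincut G (star v)
    star-isMincut {v} v≢w =
      star-isEdgeCut v≢w , λ T cutT → subst (_≤ ∣ T ∣) (sym (regular v)) (edgeCut-size T cutT)

  -- The edge from `u` to `w` also lies in the star of `v`, so one of its ends is `v`, and that end
  -- is not `u`.
  same-star⇒unique-neighbour : ∀ {u v w} → u ≢ v → star u ≡ star v → Adj G u w → w ≡ v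
  same-star⇒unique-neighbour u≢v eq uw with e , joins ← Adj⇒Joins uw
    with Joins-∈⇒endpoint joins (subst (e ∈_) eq (Joins⇒∈ˡ joins))
  ... | inj₁ u≡v = contradiction u≡v u≢v
  ... | inj₂ w≡v = w≡v

  same-star⇒≅K₂ : Connected G → ∀ {u v} → u ≢ v → star u ≡ star v → G ≅ K 2
  same-star⇒≅K₂ connected {u} {v} u≢v eq =
    mk↔ₛ′ to from to∘from from∘to , λ x y → mk⇔ (Adj⇒≢ x y) (≢⇒Adj x y)
    where
    -- A walk that starts in the pair can only alternate between `u` and `v`; by connectedness these
    -- are then all the vertices.
    reach : ∀ {x w} → x ≡ u ⊎ x ≡ v → Star (Adj G) x w → w ≡ u ⊎ w ≡ v
    reach x∈uv ε = x∈uv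
    reach (inj₁ refl) (ux ◅ xs) = reach (inj₂ (same-star⇒unique-neighbour u≢v eq ux)) xs
    reach (inj₂ refl) (vx ◅ xs) =
      reach (inj₁ (same-star⇒unique-neighbour (u≢v ∘ sym) (sym eq) vx)) xs

    u-or-v : ∀ w → w ≡ u ⊎ w ≡ v
    u-or-v w = reach (inj₁ refl) (connected u w)

    uv : Adj G u v
    -- The first step of a walk from `u` to `v` leads to a neighbour of `u`, which can only be `v`.
    uv with connected u v
    ... | ε = contradiction refl u≢v
    ... | ux ◅ _ = subst (Adj G u) (same-star⇒unique-neighbour u≢v eq ux) ux

    to : Fin n → Fin 2
    to w with w ≟ u
    ... | yes _ = zero
    ... | no _ = suc zero

    from : Fin 2 → Fin n
    from zero = u
    from (suc zero) = v

    to∘from : ∀ i → to (from i) ≡ i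
    to∘from zero with u ≟ u
    ... | yes _ = refl
    ... | no u≢u = contradiction refl u≢u
    to∘from (suc zero) with v ≟ u
    ... | yes v≡u = contradiction (sym v≡u) u≢v
    ... | no _ = refl

    from∘to : ∀ w → from (to w) ≡ w
    from∘to w with w ≟ u | u-or-v w
    ... | yes w≡u | _ = sym w≡u
    ... | no w≢u | inj₁ w≡u = contradiction w≡u w≢u
    ... | no _ | inj₂ w≡v = sym w≡v

    Adj⇒≢ : ∀ x y → Adj G x y → to x ≢ to y
    Adj⇒≢ x y xy eq = irrefl G (subst (Adj G x)
      (trans (sym (from∘to y)) (trans (cong from (sym eq)) (from∘to x))) xy)

    ≢⇒Adj : ∀ x y → to x ≢ to y → Adj G x y
    ≢⇒Adj x y to≢ with u-or-v x | u-or-v y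
    ... | inj₁ refl | inj₁ refl = contradiction refl to≢
    ... | inj₁ refl | inj₂ refl = uv
    ... | inj₂ refl | inj₁ refl = symm G uv
    ... | inj₂ refl | inj₂ refl = contradiction refl to≢

  star-injective : Connected G → ¬ (G ≅ K 2) → ∀ {u v} → star u ≡ star v → u ≡ v
  star-injective connected ≇K₂ {u} {v} eq =
    decidable-stable (u ≟ v) λ u≢v → ≇K₂ (same-star⇒≅K₂ connected u≢v eq)

  isStar? : ∀ S → Dec (∃[ v ] S ≡ star v)
  isStar? S = any? λ v → ≡-dec _≟ᵇ_ S (star v)

  -- A mincut carries its proof only irrelevantly, so its centre is found by search.
  mincut-isStar : SuperLambda G → (s : Mincut G) → ∃[ v ] value s ≡ star v
  mincut-isStar superλ (S , [ mincut ]) = recompute (isStar? S)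
    (let v , _ , eq = superλ S mincut in v , eq)

corollary4p4 : (n : ℕ) → 2 ≤ n → (G : SimpleGraph (Fin n)) → Connected G →
    SuperLambda G → (r : ℕ) → Regular G r → ¬ (G ≅ K 2) → mincutGraph G ≅ G
corollary4p4 n (s≤s (s≤s _)) G connected superλ r regular ≇K₂ =
  mk↔ₛ′ centre starCut centre∘starCut starCut∘centre , λ s t → mk⇔ (meet⇒Adj s t) (Adj⇒meet s t)
  where
  centre : Mincut G → Fin n
  centre s = proj₁ (mincut-isStar G superλ s)

  value≡star : ∀ s → value s ≡ incidentEdges G (centre s)
  value≡star s = proj₂ (mincut-isStar G superλ s)

  starCut : Fin n → Mincut G
  starCut v = incidentEdges G v ,
    -- The second vertex needed for the star to be a cut is `punchIn v zero`, which exists because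
    -- `2 ≤ n`.
    [ star-isMincut G superλ regular (punchInᵢ≢i v zero ∘ sym) ]

  -- The search is only known to return some vertex with the same star as `v`; injectivity of stars
  -- identifies it with `v`.
  centre∘starCut : ∀ v → centre (starCut v) ≡ v
  centre∘starCut v = sym (star-injective G connected ≇K₂ (value≡star (starCut v)))

  starCut∘centre : ∀ s → starCut (centre s) ≡ s
  starCut∘centre s = value-injective (sym (value≡star s))

  centre-injective : ∀ {s t} → centre s ≡ centre t → s ≡ t
  centre-injective {s} {t} eq =
    trans (sym (starCut∘centre s)) (trans (cong starCut eq) (starCut∘centre t))

  meet⇒Adj : ∀ s t → Adj (mincutGraph G) s t → Adj G (centre s) (centre t)
  meet⇒Adj s t (s≢t , e , e∈s∩t) with e∈s , e∈t ← x∈p∩q⁻ (value s) (value t) e∈s∩t =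
    common-edge⇒Adj G (s≢t ∘ centre-injective)
      (subst (e ∈_) (value≡star s) e∈s) (subst (e ∈_) (value≡star t) e∈t)

  Adj⇒meet : ∀ s t → Adj G (centre s) (centre t) → Adj (mincutGraph G) s t
  Adj⇒meet s t adj =
    -- If the two mincuts were equal, their common centre would carry a loop.
    (λ s≡t → irrefl G (subst (λ x → Adj G (centre s) (centre x)) (sym s≡t) adj)) ,
    subst₂ (λ S T → Nonempty (S ∩ T)) (sym (value≡star s)) (sym (value≡star t))
      (Adj⇒stars-meet G adj)
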